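{- Every hypergame $x$ has a non-losing strategy for at least one of the players L, R, I, II.
   Context: Hypergames: work in a universe of possibly non-wellfounded sets (set theory with the Antifoundation Axiom, and the Axiom of Choice). The class $\mathcal H$ of hypergames (also called games) is the carrier of the final coalgebra $(\mathcal H,\mathrm{id})$ of the functor $F(A)=\mathcal P(A)\times\mathcal P(A)$ on the category of classes and functional classes, where $\mathcal P$ is the powerset functor. Thus a hypergame is a pair $x=(X^L,X^R)$ of sets of hypergames; elements $x^L\in X^L$ and $x^R\in X^R$ are the Left and Right options of $x$. Positions of $x$ are the hypergames hereditarily reachable from $x$. Plays: L (Left) and R (Right) move alternately; either may start. Player I is the one who starts, player II the other one; LI means L acting as player I, and similarly LII, RI, RII. A play on $x$ is a (possibly empty) finite or infinite sequence $x_1^{K_1}x_2^{K_2}\cdots$ with $K_i\in\{L,R\}$ and $K_{i+1}\neq K_i$, such that, with $x_0=x$ and $x_i=(X_i^L,X_i^R)$, one has $x_{i+1}\in X_i^{K_{i+1}}$ for all $i\ge 0$. A finite play is winning for L (resp. R) if it ends with a position $y=(Y^L,Y^R)$ where R (resp. L) is next to move but $Y^R=\emptyset$ (resp. $Y^L=\emptyset$); the empty play ends at $x$ with the starting player next to move. Every infinite play is a draw. A play is non-losing for L (resp. R) if it is winning for L (resp. R) or is a draw. Strategies: for P in $\{$LI, LII, RI, RII$\}$ let $\mathrm{FPlay}^P_x$ be the set of finite plays on $x$ in which P has the prescribed role (first or second player) and is next to move (the empty play is included exactly when P is LI or RI). A strategy for P on $x$ is a partial function $f$ from $\mathrm{FPlay}^P_x$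 to positions of $x$ such that $f(\pi)=x'$ implies that $\pi x'$ is a play, and $f(\pi)$ is defined whenever some $\pi x'$ is a play. The opponent of LI is RII, and of LII is RI (and conversely). A play $\pi$ is coherent with $f$ if for each proper prefix $\pi'$ of $\pi$ where P is next to move, $f(\pi')=x'$ implies $\pi'x'$ is a prefix of $\pi$. For a strategy $f$ for P and a strategy $f'$ for the opponent, $f*f'$ is the unique maximal play coherent with both. $f$ is non-losing (winning) for P if $f*f'$ is non-losing (winning) for P (i.e. for L or R accordingly) for every strategy $f'$ of the opponent. A strategy for L is a pair of strategies for LI and LII; for R, for RI and RII; for I, for LI and RI; for II, for LII and RII. Such a pair is non-losing (winning) if both components are. -}

module Defs where

open import Data.Empty.Polymorphic using (⊥)
open import Data.Maybe using (Maybe; just; Is-just)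
open import Data.Maybe.Relation.Binary.Pointwise using (Pointwise)
open import Data.Nat.Base using (ℕ; zero; suc)
open import Data.Product.Base using (Σ; ∃; _×_; _,_; proj₁; proj₂)
open import Data.Sum.Base using (_⊎_; inj₁; inj₂)
open import Data.Unit.Polymorphic using (⊤)
open import Function.Bundles using (Func)
open import Level using (Level; 0ℓ; _⊔_) renaming (suc to lsuc)
open import Relation.Binary.Bundles using (Setoid)
open import Relation.Binary.Core using (REL)
open import Relation.Binary.Definitions using (_Respectsˡ_; _Respectsʳ_)
open import Relation.Binary.PropositionalEquality.Core using (_≡_; refl)
open import Relation.Binary.Structures using (IsEquivalence)
open import Relation.Nullary.Negation.Core using (¬_)

-- The Axiom of Choice of the ambient set theory.  A set with its equality is
-- a setoid here, so a choice function has to respect the two equalities (for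
-- relations that do); choice without this requirement is a triviality in type
-- theory.

AxiomOfChoice : (a ℓ : Level) → Set (lsuc (a ⊔ ℓ))
AxiomOfChoice a ℓ =
  (S T : Setoid a ℓ) (_∼_ : REL (Carrier S) (Carrier T) ℓ) →
  _∼_ Respectsˡ (Setoid._≈_ S) → _∼_ Respectsʳ (Setoid._≈_ T) →
  (∀ s → ∃ λ t → s ∼ t) →
  Σ (Func S T) λ f → ∀ s → s ∼ Func.to f s
  where open Setoid using (Carrier)

data Side : Set where
  L R : Side

opp : Side → Side
opp L = R
opp R = L

-- Under the Antifoundation Axiom a hypergame is what is pictured by a pointed
-- graph with two kinds of edges, and two pointed graphs picture the same
-- hypergame iff they are bisimilar.  So hypergames are small pointed graphs,
-- and their equality is _≈_ below.  That this is the final coalgebra of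
-- P(-) × P(-) is checked in ≈-extensional, unfold-hom and hom-unique.

record Hypergame : Set₁ where
  field
    Node  : Set
    Index : Side → Node → Set
    next  : (K : Side) (n : Node) → Index K n → Node
    root  : Node

open Hypergame

-- The set X^K of x = (X^L , X^R) is { option x K i | i }.

option : (x : Hypergame) (K : Side) → Index x K (root x) → Hypergame
option x K i = record x { root = next x K (root x) i }

record IsBisimulation (x y : Hypergame) (_∼_ : REL (Node x) (Node y) 0ℓ) : Set where
  field
    forth : ∀ {m n} → m ∼ n → ∀ K (i : Index x K m) →
            Σ (Index y K n) λ j → next x K m i ∼ next y K n j
    back  : ∀ {m n} → m ∼ n → ∀ K (j : Index y K n) →
            Σ (Index x K m) λ i → next x K m i ∼ next y K n j

open IsBisimulation

infix 4 _≈_ _∈_^_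

record _≈_ (x y : Hypergame) : Set₁ where
  constructor mk≈
  field
    relation      : REL (Node x) (Node y) 0ℓ
    isBisimulation : IsBisimulation x y relation
    roots         : relation (root x) (root y)

open _≈_

_∈_^_ : Hypergame → Hypergame → Side → Set₁
y ∈ x ^ K = Σ (Index x K (root x)) λ i → option x K i ≈ y

≈-refl : ∀ {x} → x ≈ x
≈-refl = mk≈ _≡_
  (record { forth = λ { refl K i → i , refl } ; back = λ { refl K j → j , refl } }) refl

≈-sym : ∀ {x y} → x ≈ y → y ≈ x
≈-sym (mk≈ _∼_ b r) =
  mk≈ (λ n m → m ∼ n) (record { forth = back b ; back = forth b }) r

≈-trans : ∀ {x y z} → x ≈ y → y ≈ z → x ≈ z
≈-trans {x} {y} {z} (mk≈ _∼_ b r) (mk≈ _∼′_ b′ r′) = mk≈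
  (λ m o → ∃ λ n → m ∼ n × n ∼′ o)
  (record
    { forth = λ (n , p , q) K i →
        let (j , p′) = forth b p K i ; (k , q′) = forth b′ q K j in k , _ , p′ , q′
    ; back  = λ (n , p , q) K k →
        let (j , q′) = back b′ q K k ; (i , p′) = back b p K j in i , _ , p′ , q′
    })
  (_ , r , r′)

≈-isEquivalence : IsEquivalence _≈_
≈-isEquivalence = record { refl = ≈-refl ; sym = ≈-sym ; trans = ≈-trans }

infix 4 _⊆ᴼ_

_⊆ᴼ_ : Hypergame → Hypergame → Set₁
x ⊆ᴼ y = ∀ K (i : Index x K (root x)) → option x K i ∈ y ^ K

≈⇒⊆ᴼ : ∀ {x y} → x ≈ y → x ⊆ᴼ y
≈⇒⊆ᴼ (mk≈ _∼_ b r) K i =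
  let (j , r′) = forth b r K i
  in  j , ≈-sym (mk≈ _∼_ (record { forth = forth b ; back = back b }) r′)

≈-extensional : ∀ {x y} → x ⊆ᴼ y → y ⊆ᴼ x → x ≈ y
≈-extensional {x} {y} f g = mk≈ _∼_ bisim root∼
  where
  data _∼_ : Node x → Node y → Set where
    root∼  : root x ∼ root y
    left∼  : ∀ {m n} K i → relation (proj₂ (f K i)) n m → m ∼ n
    right∼ : ∀ {m n} K j → relation (proj₂ (g K j)) m n → m ∼ n

  bisim : IsBisimulation x y _∼_
  forth bisim root∼          K i = _ , left∼ K i (roots (proj₂ (f K i)))
  forth bisim (left∼ K′ k r) K i =
    let (j , r′) = back (isBisimulation (proj₂ (f K′ k))) r K i in j , left∼ K′ k r′
  forth bisim (right∼ K′ k r) K i =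
    let (j , r′) = forth (isBisimulation (proj₂ (g K′ k))) r K i in j , right∼ K′ k r′
  back bisim root∼           K j = _ , right∼ K j (roots (proj₂ (g K j)))
  back bisim (left∼ K′ k r)  K j =
    let (i , r′) = forth (isBisimulation (proj₂ (f K′ k))) r K j in i , left∼ K′ k r′
  back bisim (right∼ K′ k r) K j =
    let (i , r′) = back (isBisimulation (proj₂ (g K′ k))) r K j in i , right∼ K′ k r′

record Coalgebra : Set₂ where
  field
    Carrier : Set₁
    Ix      : Side → Carrier → Set
    out     : (K : Side) (a : Carrier) → Ix K a → Carrier

module _ (C : Coalgebra) where
  open Coalgebra C

  record IsHom (h : Carrier → Hypergame) : Set₁ where
    field
      to   : ∀ a K (i : Ix K a) → h (out K a i) ∈ h a ^ K
      from : ∀ a K (j : Index (h a) K (root (h a))) →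
             Σ (Ix K a) λ i → option (h a) K j ≈ h (out K a i)

  data Path (a : Carrier) : Set where
    here  : Path a
    there : (K : Side) (i : Ix K a) → Path (out K a i) → Path a

  end : ∀ {a} → Path a → Carrier
  end {a} here        = a
  end     (there K i p) = end p

  snoc : ∀ {a} (p : Path a) (K : Side) → Ix K (end p) → Path a
  snoc here          K i = there K i here
  snoc (there K′ j p) K i = there K′ j (snoc p K i)

  unfold : Carrier → Hypergame
  unfold a = record
    { Node  = Path a
    ; Index = λ K p → Ix K (end p)
    ; next  = λ K p → snoc p K
    ; root  = here
    }

  unfold-hom : IsHom unfold
  unfold-hom = record { to = λ a K i → i , eq a K i ; from = λ a K i → i , eq a K i }
    where
    eq : ∀ a K i → option (unfold a) K i ≈ unfold (out K a i)
    eq a K i = mk≈ (λ p q → p ≡ there K i q)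
      (record { forth = λ { refl K′ j → j , refl } ; back = λ { refl K′ j → j , refl } })
      refl

  hom-unique : ∀ {h k} → IsHom h → IsHom k → ∀ a → h a ≈ k a
  hom-unique {h} {k} H H′ a = mk≈ (Rel a) (bisim a) start
    where
    open IsHom

    data Rel (a : Carrier) : Node (h a) → Node (k a) → Set where
      start : Rel a (root (h a)) (root (k a))
      fwd   : ∀ K j {m m′ n n′} → let i = proj₁ (from H a K j) in
              relation (proj₂ (from H a K j)) m m′ → Rel (out K a i) m′ n′ →
              relation (proj₂ (to H′ a K i)) n n′ → Rel a m n
      bwd   : ∀ K j {m m′ n n′} → let i = proj₁ (from H′ a K j) in
              relation (proj₂ (to H a K i)) m m′ → Rel (out K a i) m′ n′ →
              relation (proj₂ (from H′ a K j)) n n′ → Rel a m n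

    bisim : ∀ a → IsBisimulation (h a) (k a) (Rel a)
    forth (bisim a) start K j =
      _ , fwd K j (roots (proj₂ (from H a K j))) start (roots (proj₂ (to H′ a K _)))
    forth (bisim a) (fwd K j p r q) K′ i =
      let (_ , p′) = forth (isBisimulation (proj₂ (from H a K j))) p K′ i
          (_ , r′) = forth (bisim _) r K′ _
          (_ , q′) = back (isBisimulation (proj₂ (to H′ a K _))) q K′ _
      in _ , fwd K j p′ r′ q′
    forth (bisim a) (bwd K j p r q) K′ i =
      let (_ , p′) = forth (isBisimulation (proj₂ (to H a K _))) p K′ i
          (_ , r′) = forth (bisim _) r K′ _
          (_ , q′) = back (isBisimulation (proj₂ (from H′ a K j))) q K′ _
      in _ , bwd K j p′ r′ q′
    back (bisim a) start K j =
      _ , bwd K j (roots (proj₂ (to H a K _))) start (roots (proj₂ (from H′ a K j)))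
    back (bisim a) (fwd K j p r q) K′ i =
      let (_ , q′) = forth (isBisimulation (proj₂ (to H′ a K _))) q K′ i
          (_ , r′) = back (bisim _) r K′ _
          (_ , p′) = back (isBisimulation (proj₂ (from H a K j))) p K′ _
      in _ , fwd K j p′ r′ q′
    back (bisim a) (bwd K j p r q) K′ i =
      let (_ , q′) = forth (isBisimulation (proj₂ (from H′ a K j))) q K′ i
          (_ , r′) = back (bisim _) r K′ _
          (_ , p′) = back (isBisimulation (proj₂ (to H a K _))) p K′ _
      in _ , bwd K j p′ r′ q′

module _ (s : Side) (x : Hypergame) where

  -- Finite plays on x in which s starts; the labels K_i are determined by s.

  data FinPlay : Set₁
  turn : FinPlay → Side
  last : FinPlay → Hypergame

  -- Extension π: the x′ for which π x′ is again a play.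

  Extension : FinPlay → Set₁
  Extension π = Σ Hypergame λ y → y ∈ last π ^ turn π

  infixl 5 _▷_

  data FinPlay where
    []  : FinPlay
    _▷_ : (π : FinPlay) → Extension π → FinPlay

  turn []      = s
  turn (π ▷ _) = opp (turn π)

  last []            = x
  last (_ ▷ (y , _)) = y

  mover : ℕ → Side
  mover zero    = s
  mover (suc n) = opp (mover n)

  -- The sequence x_0 x_1 x_2 ⋯ from the play x_1 x_2 ⋯.

  prepend : (ℕ → Hypergame) → ℕ → Hypergame
  prepend ys zero    = x
  prepend ys (suc n) = ys n

  -- position n is x_{n+1}.

  record InfPlay : Set₁ where
    field
      position : ℕ → Hypergame
      legal    : ∀ n → position n ∈ prepend position n ^ mover n

  data Play : Set₁ where
    fin : FinPlay → Play
    inf : InfPlay → Play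

module _ {s : Side} {x : Hypergame} where
  open InfPlay

  length : FinPlay s x → ℕ
  length []      = zero
  length (π ▷ _) = suc (length π)

  infix 4 _≋_ _⊑_ _⊏_ _≤ᴾ_ _≈ᴾ_

  -- Plays are compared as sequences of hypergames modulo _≈_.

  _≋_ : FinPlay s x → FinPlay s x → Set₁
  []            ≋ []            = ⊤
  (π ▷ (y , _)) ≋ (σ ▷ (z , _)) = π ≋ σ × y ≈ z
  []            ≋ (_ ▷ _)       = ⊥
  (_ ▷ _)       ≋ []            = ⊥

  _⊑_ : FinPlay s x → Play s x → Set₁
  π             ⊑ fin []      = π ≋ []
  π             ⊑ fin (σ ▷ e) = π ≋ (σ ▷ e) ⊎ π ⊑ fin σ
  []            ⊑ inf ρ       = ⊤
  (π ▷ (y , _)) ⊑ inf ρ       = π ⊑ inf ρ × y ≈ position ρ (length π)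

  _⊏_ : FinPlay s x → Play s x → Set₁
  π ⊏ τ = Σ (Extension s x π) λ e → (π ▷ e) ⊑ τ

  _≤ᴾ_ : Play s x → Play s x → Set₁
  fin π ≤ᴾ τ      = π ⊑ τ
  inf ρ ≤ᴾ fin _  = ⊥
  inf ρ ≤ᴾ inf ρ′ = ∀ n → position ρ n ≈ position ρ′ n

  _≈ᴾ_ : Play s x → Play s x → Set₁
  τ ≈ᴾ τ′ = τ ≤ᴾ τ′ × τ′ ≤ᴾ τ

  WinningPlay : Side → Play s x → Set₁
  WinningPlay K (fin π) = turn s x π ≡ opp K × (∀ y → ¬ (y ∈ last s x π ^ opp K))
  WinningPlay K (inf _) = ⊥

  Draw : Play s x → Set₁
  Draw (fin _) = ⊥
  Draw (inf _) = ⊤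

  NonLosingPlay : Side → Play s x → Set₁
  NonLosingPlay K τ = WinningPlay K τ ⊎ Draw τ

-- Strategies on x for K in the plays started by s: partial functions, with
-- `nothing` for undefined.  That π f(π) is a play (hence f(π) a position of x)
-- is part of the type of `move`.

record Strategy (s K : Side) (x : Hypergame) : Set₁ where
  field
    move     : (π : FinPlay s x) → turn s x π ≡ K → Maybe (Extension s x π)
    defined  : ∀ π p → Extension s x π → Is-just (move π p)
    respects : ∀ {π σ} → π ≋ σ → ∀ p q →
               Pointwise (λ e e′ → proj₁ e ≈ proj₁ e′) (move π p) (move σ q)

open Strategy

module _ {s : Side} {x : Hypergame} where

  Coherent : ∀ {K} → Strategy s K x → Play s x → Set₁
  Coherent {K} f τ = ∀ π → π ⊏ τ → (p : turn s x π ≡ K) →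
                     ∀ e → move f π p ≡ just e → (π ▷ e) ⊑ τ

  module _ {K} (f : Strategy s K x) (f′ : Strategy s (opp K) x) where

    record IsMaximalCoherent (τ : Play s x) : Set₁ where
      field
        coherent  : Coherent f τ
        coherent′ : Coherent f′ τ
        maximal   : ∀ τ′ → Coherent f τ′ → Coherent f′ τ′ → τ ≤ᴾ τ′ → τ′ ≤ᴾ τ

    -- τ is f * f′, the unique maximal play coherent with both.

    IsProduct : Play s x → Set₁
    IsProduct τ = IsMaximalCoherent τ × (∀ τ′ → IsMaximalCoherent τ′ → τ ≈ᴾ τ′)

  NonLosing : ∀ {K} → Strategy s K x → Set₁
  NonLosing {K} f = (f′ : Strategy s (opp K) x) →
                    Σ (Play s x) λ τ → IsProduct f f′ τ × NonLosingPlay K τ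

data Role : Set where
  LI LII RI RII : Role

side : Role → Side
side LI  = L
side LII = L
side RI  = R
side RII = R

starter : Role → Side
starter LI  = L
starter LII = R
starter RI  = R
starter RII = L

data Player : Set where
  L R I II : Player

roles : Player → Role × Role
roles L  = LI  , LII
roles R  = RI  , RII
roles I  = LI  , RI
roles II = LII , RII

RoleStrategy : Role → Hypergame → Set₁
RoleStrategy P = Strategy (starter P) (side P)

PlayerStrategy : Player → Hypergame → Set₁
PlayerStrategy P x = let (P₁ , P₂) = roles P in RoleStrategy P₁ x × RoleStrategy P₂ x

NonLosingᴾ : ∀ P {x} → PlayerStrategy P x → Set₁
NonLosingᴾ P (f , g) = NonLosing f × NonLosing g

{-# OPTIONS --safe #-}
module Submission where

-- Plays started by a fixed side s are determined up to draws, and the theorem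
-- follows by combining the cases s = L and s = R.
--
-- Wins K t u, a least fixed point, says that K can force a win from the
-- position u with t to move.  It excludes Wins (opp K) t u (Wins-disjoint), so
-- at the start at least one of the sides K is safe, in the sense that opp K
-- cannot force a win.  From a safe position where K is to move, excluded
-- middle yields a safe option (safe-option); from a safe position where opp K
-- is to move, every option is safe; and a safe position where K is to move is
-- never a dead end.  Hence a strategy for K that keeps to safe positions loses
-- no play, and a play that goes on forever is a draw.
--
-- Strategies respect equality of hypergames, which is bisimilarity.  Every
-- position of x is bisimilar to a node of x, and the nodes form a set, so the
-- axiom of choice for the nodes modulo bisimilarity gives a choice of options
-- (reply-exists) which depends on the current position only and respects
-- bisimilarity; from it the strategy cautious is built.
--
-- The product of f and f′ is found from the finite plays all of whose moves
-- answer f or f′ (Run).  Up to equality there is at most one of each length,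
-- and a play whose finite prefixes are exactly these (Outcome) is coherent
-- with f and f′ and has every coherent play as a prefix, so that it is f * f′
-- (outcome-product). It is the run that cannot be extended if there is one,
-- and the limit of the runs otherwise.

open import Axiom.ExcludedMiddle using (ExcludedMiddle)
open import Data.Empty.Polymorphic using (⊥-elim)
open import Data.Maybe using (Maybe; just; nothing; Is-just)
open import Data.Maybe.Relation.Binary.Pointwise using (Pointwise; just; nothing)
open import Data.Maybe.Relation.Unary.Any using (just)
open import Data.Nat.Base using (ℕ; zero; _≤_) renaming (suc to 1+)
open import Data.Nat.Properties using (1+n≰n; m≤n⇒m≤1+n; ≤-reflexive; suc-injective)
open import Data.Product.Base using (Σ; ∃; _×_; _,_; proj₁; proj₂)
open import Data.Sum.Base using (_⊎_; inj₁; inj₂)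
open import Data.Unit.Polymorphic using (⊤; tt)
open import Function.Bundles using (Func)
open import Level using (0ℓ; suc)
open import Relation.Binary.Bundles using (Setoid)
open import Relation.Binary.PropositionalEquality
  using (_≡_; refl; sym; trans; cong; subst; subst₂)
open import Relation.Nullary.Decidable.Core using (Dec; yes; no; decidable-stable)
open import Relation.Nullary.Negation.Core using (¬_; contradiction)
open import Defs

open Hypergame
open InfPlay
open Strategy

-- Sides, options and membership

opp-irrefl : ∀ {t} K → t ≡ K → ¬ t ≡ opp K
opp-irrefl L refl ()
opp-irrefl R refl ()

side-cases : ∀ K t → t ≡ K ⊎ t ≡ opp K
side-cases L L = inj₁ refl
side-cases L R = inj₂ refl
side-cases R L = inj₂ refl
side-cases R R = inj₁ refl

-- The hypergame pictured by the node n of x.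

at : (x : Hypergame) → Node x → Hypergame
at x n = record x { root = n }

∈-respʳ : ∀ {y u v} K → u ≈ v → y ∈ u ^ K → y ∈ v ^ K
∈-respʳ K u≈v (i , e) =
  let (j , e′) = ≈⇒⊆ᴼ u≈v K i in j , ≈-trans e′ e

∈-respˡ : ∀ {y z u} K → y ≈ z → y ∈ u ^ K → z ∈ u ^ K
∈-respˡ K y≈z (i , e) = i , ≈-trans e y≈z

-- Forced wins

-- K can force a win from u with t to move: if it is K's turn, some option is
-- again such a position; otherwise all options are, and possibly there are
-- none.  Options range over all hypergames equal to one, which makes the
-- predicate respect equality by construction.

data Wins (K t : Side) (u : Hypergame) : Set₁ where
  choose : t ≡ K → ∀ {y} → y ∈ u ^ t → Wins K (opp t) y → Wins K t u
  await  : t ≡ opp K → (∀ y → y ∈ u ^ t → Wins K (opp t) y) → Wins K t u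

Wins-resp : ∀ {K t u v} → u ≈ v → Wins K t u → Wins K t v
Wins-resp {t = t} u≈v (choose p m w) = choose p (∈-respʳ t u≈v m) w
Wins-resp {t = t} u≈v (await p h)    = await p λ y m → h y (∈-respʳ t (≈-sym u≈v) m)

Wins-disjoint : ∀ K {t u} → Wins K t u → ¬ Wins (opp K) t u
Wins-disjoint K (choose p m w) (choose q _ _) = opp-irrefl K p q
Wins-disjoint K (choose p m w) (await q h)    = Wins-disjoint K w (h _ m)
Wins-disjoint K (await p h)    (choose q m w) = Wins-disjoint K (h _ m) w
Wins-disjoint K (await p h)    (await q h′)   = opp-irrefl (opp K) p q

-- The opponent of K cannot force a win from u with t to move.

Safe : (K t : Side) (u : Hypergame) → Set₁
Safe K t u = ¬ Wins (opp K) t u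

Safe-resp : ∀ {K t u v} → u ≈ v → Safe K t u → Safe K t v
Safe-resp u≈v safe w = safe (Wins-resp (≈-sym u≈v) w)

opp-involutive : ∀ K → opp (opp K) ≡ K
opp-involutive L = refl
opp-involutive R = refl

-- The opponent cannot leave the safe positions of K.

safe-opponent : ∀ {K t u y} → t ≡ opp K → Safe K t u → y ∈ u ^ t → Safe K (opp t) y
safe-opponent p safe m w = safe (choose p m w)

-- A dead end is lost for the side to move.

safe-not-stuck : ∀ {K t u} → t ≡ K → Safe K t u → ¬ (∀ y → ¬ (y ∈ u ^ t))
safe-not-stuck {K} p safe none =
  safe (await (trans p (sym (opp-involutive K))) λ y m → contradiction m (none y))

module _ (em : ExcludedMiddle (suc 0ℓ)) where

  safe-option : ∀ {K t u} → t ≡ K → Safe K t u →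
                ∃ λ y → y ∈ u ^ t × Safe K (opp t) y
  safe-option {K} {t} {u} p safe = decidable-stable em λ none →
    safe (await (trans p (sym (opp-involutive K))) λ y m →
      decidable-stable em λ ¬w → none (y , m , ¬w))

-- Finite plays modulo equality

module _ {s : Side} {x : Hypergame} where

  ≋-refl : (π : FinPlay s x) → π ≋ π
  ≋-refl []      = tt
  ≋-refl (π ▷ _) = ≋-refl π , ≈-refl

  ≋-sym : {π σ : FinPlay s x} → π ≋ σ → σ ≋ π
  ≋-sym {[]}    {[]}    _       = tt
  ≋-sym {_ ▷ _} {_ ▷ _} (p , q) = ≋-sym p , ≈-sym q

  ≋-turn : {π σ : FinPlay s x} → π ≋ σ → turn s x π ≡ turn s x σ
  ≋-turn {[]}    {[]}    _       = refl
  ≋-turn {_ ▷ _} {_ ▷ _} (p , _) = cong opp (≋-turn p)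

  ≋-last : {π σ : FinPlay s x} → π ≋ σ → last s x π ≈ last s x σ
  ≋-last {[]}    {[]}    _       = ≈-refl
  ≋-last {_ ▷ _} {_ ▷ _} (_ , q) = q

  ≋-extension : {π σ : FinPlay s x} → π ≋ σ → Extension s x π → Extension s x σ
  ≋-extension {π} {σ} p (y , m) =
    y , subst (λ K → y ∈ last s x σ ^ K) (≋-turn p) (∈-respʳ (turn s x π) (≋-last p) m)

  -- The prefix relation

  ≋⇒⊑ : {π : FinPlay s x} (σ : FinPlay s x) → π ≋ σ → π ⊑ fin σ
  ≋⇒⊑ []      p = p
  ≋⇒⊑ (_ ▷ _) p = inj₁ p

  ⊑-init : (π : FinPlay s x) {e : Extension s x π} (τ : Play s x) →
           (π ▷ e) ⊑ τ → π ⊑ τ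
  ⊑-init π (fin [])      p              = ⊥-elim p
  ⊑-init π (fin (σ ▷ _)) (inj₁ (p , _)) = inj₂ (≋⇒⊑ σ p)
  ⊑-init π (fin (σ ▷ _)) (inj₂ p)       = inj₂ (⊑-init π (fin σ) p)
  ⊑-init π (inf _)       (p , _)        = p

  ≋-length : {π σ : FinPlay s x} → π ≋ σ → length π ≡ length σ
  ≋-length {[]}    {[]}    _       = refl
  ≋-length {_ ▷ _} {_ ▷ _} (p , _) = cong 1+ (≋-length p)

  ⊑-length : (π σ : FinPlay s x) → π ⊑ fin σ → length π ≤ length σ
  ⊑-length π []      p        = ≤-reflexive (≋-length p)
  ⊑-length π (σ ▷ _) (inj₁ p) = ≤-reflexive (≋-length p)
  ⊑-length π (σ ▷ _) (inj₂ p) = m≤n⇒m≤1+n (⊑-length π σ p)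

  ⊑-functional : (π : FinPlay s x) (e e′ : Extension s x π) (τ : Play s x) →
                 (π ▷ e) ⊑ τ → (π ▷ e′) ⊑ τ → proj₁ e ≈ proj₁ e′
  ⊑-functional π e e′ (fin []) p _ = ⊥-elim p
  ⊑-functional π e e′ (fin (σ ▷ _)) (inj₁ (_ , p)) (inj₁ (_ , q)) =
    ≈-trans p (≈-sym q)
  ⊑-functional π e e′ (fin (σ ▷ _)) (inj₁ (p , _)) (inj₂ q) =
    contradiction (subst (1+ _ ≤_) (sym (≋-length p)) (⊑-length (π ▷ e′) σ q)) 1+n≰n
  ⊑-functional π e e′ (fin (σ ▷ _)) (inj₂ p) (inj₁ (q , _)) =
    contradiction (subst (1+ _ ≤_) (sym (≋-length q)) (⊑-length (π ▷ e) σ p)) 1+n≰n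
  ⊑-functional π e e′ (fin (σ ▷ _)) (inj₂ p) (inj₂ q) =
    ⊑-functional π e e′ (fin σ) p q
  ⊑-functional π e e′ (inf _) (_ , p) (_ , q) = ≈-trans p (≈-sym q)

  -- The first n moves of an infinite play.

  module _ (ρ : InfPlay s x) where

    take      : ℕ → FinPlay s x
    last-take : ∀ n → prepend s x (position ρ) n ≡ last s x (take n)
    turn-take : ∀ n → mover s x n ≡ turn s x (take n)

    take zero    = []
    take (1+ n) = take n ▷
      (position ρ n ,
       subst₂ (λ u K → position ρ n ∈ u ^ K) (last-take n) (turn-take n) (legal ρ n))

    last-take zero    = refl
    last-take (1+ _) = refl

    turn-take zero    = refl
    turn-take (1+ n) = cong opp (turn-take n)

    length-take : ∀ n → length (take n) ≡ n
    length-take zero    = refl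
    length-take (1+ n) = cong 1+ (length-take n)

    take-⊑ : ∀ n → take n ⊑ inf ρ
    take-⊑ zero    = tt
    take-⊑ (1+ n) rewrite length-take n = take-⊑ n , ≈-refl

  -- One play is a prefix of another as soon as its finite prefixes are.

  prefixes⇒≤ᴾ : (τ τ′ : Play s x) → (∀ σ → σ ⊑ τ → σ ⊑ τ′) → τ ≤ᴾ τ′
  prefixes⇒≤ᴾ (fin π) τ′       h = h π (≋⇒⊑ π (≋-refl π))
  prefixes⇒≤ᴾ (inf ρ) (fin σ)  h =
    let n = 1+ (length σ) in
    contradiction
      (subst (_≤ length σ) (length-take ρ n)
        (⊑-length (take ρ n) σ (h (take ρ n) (take-⊑ ρ n))))
      1+n≰n
  prefixes⇒≤ᴾ (inf ρ) (inf ρ′) h n =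
    subst (λ k → position ρ n ≈ position ρ′ k) (length-take ρ n)
      (proj₂ (h (take ρ (1+ n)) (take-⊑ ρ (1+ n))))

-- The product of two strategies

module _ {s : Side} {x : Hypergame} {K : Side}
         (f : Strategy s K x) (f′ : Strategy s (opp K) x) where

  -- e is the move prescribed after π, by whichever strategy is to move.

  Answers : (π : FinPlay s x) → Extension s x π → Set₁
  Answers π e = (Σ (turn s x π ≡ K)     λ p → move f  π p ≡ just e)
              ⊎ (Σ (turn s x π ≡ opp K) λ p → move f′ π p ≡ just e)

  answer : ∀ π → Extension s x π → ∃ (Answers π)
  answer π ext with side-cases K (turn s x π)
  ... | inj₁ p with move f π p in eq | defined f π p ext
  ...   | just e | _ = e , inj₁ (p , eq)
  answer π ext | inj₂ p with move f′ π p in eq | defined f′ π p ext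
  ...   | just e | _ = e , inj₂ (p , eq)

  private
    same-move : ∀ {H} (g : Strategy s H x) {π σ e e′} → π ≋ σ → ∀ p q →
                move g π p ≡ just e → move g σ q ≡ just e′ → proj₁ e ≈ proj₁ e′
    same-move g {π} {σ} π≋σ p q eq eq′
      with move g π p | move g σ q | respects g π≋σ p q
    same-move g π≋σ p q refl refl | just _ | just _ | just e≈e′ = e≈e′

  answers-unique : ∀ {π σ e e′} → π ≋ σ → Answers π e → Answers σ e′ →
                   proj₁ e ≈ proj₁ e′
  answers-unique π≋σ (inj₁ (p , eq)) (inj₁ (q , eq′)) = same-move f  π≋σ p q eq eq′
  answers-unique π≋σ (inj₂ (p , eq)) (inj₂ (q , eq′)) = same-move f′ π≋σ p q eq eq′
  answers-unique π≋σ (inj₁ (p , _)) (inj₂ (q , _)) =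
    contradiction (trans (≋-turn π≋σ) q) (opp-irrefl K p)
  answers-unique π≋σ (inj₂ (p , _)) (inj₁ (q , _)) =
    contradiction p (opp-irrefl K (trans (≋-turn π≋σ) q))

  -- Finite plays in which every move is, up to equality, the prescribed one.

  Run : FinPlay s x → Set₁
  Run []      = ⊤
  Run (π ▷ e) = Run π × ∃ λ a → Answers π a × proj₁ e ≈ proj₁ a

  Run-resp : ∀ {π σ} → π ≋ σ → Run π → Run σ
  Run-resp {[]}    {[]}    _         _                  = tt
  Run-resp {π ▷ _} {σ ▷ _} (p , e≈e′) (r , a , ans , e≈a) =
    let (b , ans′) = answer σ (≋-extension p a)
    in  Run-resp p r , b , ans′ ,
        ≈-trans (≈-sym e≈e′) (≈-trans e≈a (answers-unique p ans ans′))

  ▷-unique : ∀ {π σ} {e : Extension s x π} {e′ : Extension s x σ} →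
             π ≋ σ → Run (π ▷ e) → Run (σ ▷ e′) → proj₁ e ≈ proj₁ e′
  ▷-unique p (_ , _ , ans , e≈a) (_ , _ , ans′ , e′≈b) =
    ≈-trans e≈a (≈-trans (answers-unique p ans ans′) (≈-sym e′≈b))

  Run-unique : ∀ {π σ} → length π ≡ length σ → Run π → Run σ → π ≋ σ
  Run-unique {[]}    {[]}    _ _ _  = tt
  Run-unique {_ ▷ e} {_ ▷ e′} l r r′ =
    let p = Run-unique (suc-injective l) (proj₁ r) (proj₁ r′)
    in  p , ▷-unique {e = e} {e′} p r r′

  -- The finite prefixes of τ are exactly the runs.

  record Outcome (τ : Play s x) : Set₁ where
    field
      run    : ∀ σ → σ ⊑ τ → Run σ
      prefix : ∀ σ → Run σ → σ ⊑ τ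

  -- Every finite prefix of a coherent play is a run.

  coherent⇒run : ∀ τ → Coherent f τ → Coherent f′ τ → ∀ σ → σ ⊑ τ → Run σ
  coherent⇒run τ c c′ []      _ = tt
  coherent⇒run τ c c′ (π ▷ e) p with answer π e
  ... | a , ans = coherent⇒run τ c c′ π (⊑-init π τ p) , a , ans ,
                  ⊑-functional π e a τ p (extend ans)
    where
    extend : Answers π a → (π ▷ a) ⊑ τ
    extend (inj₁ (q , eq)) = c  π (e , p) q a eq
    extend (inj₂ (q , eq)) = c′ π (e , p) q a eq

  outcome-product : ∀ {τ} → Outcome τ → IsProduct f f′ τ
  outcome-product {τ} out = isMax , unique
    where
    open Outcome out

    answered : ∀ π → π ⊏ τ → ∀ e → Answers π e → (π ▷ e) ⊑ τ
    answered π (e′ , p) e ans =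
      prefix (π ▷ e) (run π (⊑-init π τ p) , e , ans , ≈-refl)

    greatest : ∀ τ′ → Coherent f τ′ → Coherent f′ τ′ → τ′ ≤ᴾ τ
    greatest τ′ c c′ =
      prefixes⇒≤ᴾ τ′ τ λ σ p → prefix σ (coherent⇒run τ′ c c′ σ p)

    isMax : IsMaximalCoherent f f′ τ
    isMax = record
      { coherent  = λ π p q e eq → answered π p e (inj₁ (q , eq))
      ; coherent′ = λ π p q e eq → answered π p e (inj₂ (q , eq))
      ; maximal   = λ τ′ c c′ _ → greatest τ′ c c′
      }

    unique : ∀ τ′ → IsMaximalCoherent f f′ τ′ → τ ≈ᴾ τ′
    unique τ′ m = maximal m τ (coherent isMax) (coherent′ isMax) τ′≤τ , τ′≤τ
      where
      open IsMaximalCoherent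
      τ′≤τ = greatest τ′ (coherent m) (coherent′ m)

  -- A run that cannot be extended is the outcome.

  module _ {μ : FinPlay s x} (r : Run μ) (stuck : ¬ Extension s x μ) where

    stuck-outcome : Outcome (fin μ)
    stuck-outcome = record { run = λ σ → down σ μ r ; prefix = up }
      where
      down : ∀ σ μ → Run μ → σ ⊑ fin μ → Run σ
      down σ []      r       p        = Run-resp (≋-sym p) r
      down σ (_ ▷ _) r       (inj₁ p) = Run-resp (≋-sym p) r
      down σ (μ ▷ _) (r , _) (inj₂ p) = down σ μ r p

      -- A prefix of a run is all of it or has the prescribed move next.
      next-move : ∀ {π e} μ → Run μ → Run (π ▷ e) → π ⊑ fin μ →
                  π ≋ μ ⊎ (π ▷ e) ⊑ fin μ
      next-move []      _ _  p        = inj₁ p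
      next-move (ν ▷ _) _ _  (inj₁ p) = inj₁ p
      next-move {e = e} (ν ▷ a) r r′ (inj₂ p) with next-move ν (proj₁ r) r′ p
      ... | inj₁ q = inj₂ (inj₁ (q , ▷-unique {e = e} {a} q r′ r))
      ... | inj₂ q = inj₂ (inj₂ q)

      start : ∀ μ → [] ⊑ fin μ
      start []      = tt
      start (μ ▷ _) = inj₂ (start μ)

      up : ∀ σ → Run σ → σ ⊑ fin μ
      up []      _  = start μ
      up (π ▷ e) r′ with next-move μ r r′ (up π (proj₁ r′))
      ... | inj₁ p = contradiction (≋-extension p e) stuck
      ... | inj₂ p = p

  -- If every run can be extended, the outcome is the limit of the runs.

  module _ (extend : ∀ μ → Run μ → Extension s x μ) where

    private
      longer : ∃ Run → ∃ Run
      longer (μ , r) = let (a , ans) = answer μ (extend μ r)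
                       in  μ ▷ a , r , a , ans , ≈-refl

      -- A run of length n.
      stage : ℕ → ∃ Run
      stage zero    = [] , tt
      stage (1+ n) = longer (stage n)

      length-stage : ∀ n → length (proj₁ (stage n)) ≡ n
      length-stage zero    = refl
      length-stage (1+ n) = cong 1+ (length-stage n)

      turn-stage : ∀ n → turn s x (proj₁ (stage n)) ≡ mover s x n
      turn-stage zero    = refl
      turn-stage (1+ n) = cong opp (turn-stage n)

      positions : ℕ → Hypergame
      positions n = last s x (proj₁ (stage (1+ n)))

      last-stage : ∀ n → last s x (proj₁ (stage n)) ≡ prepend s x positions n
      last-stage zero    = refl
      last-stage (1+ _) = refl

    limit : InfPlay s x
    limit = record
      { position = positions
      ; legal    = λ n →
          subst₂ (λ u K → positions n ∈ u ^ K) (last-stage n) (turn-stage n)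
            (proj₂ (proj₁ (answer (proj₁ (stage n))
                                  (extend (proj₁ (stage n)) (proj₂ (stage n))))))
      }

    limit-outcome : Outcome (inf limit)
    limit-outcome = record
      { run    = λ σ p → Run-resp (≋-sym (down σ p)) (proj₂ (stage (length σ)))
      ; prefix = λ σ r → up σ (Run-unique (sym (length-stage (length σ))) r
                                          (proj₂ (stage (length σ))))
      }
      where
      down : ∀ σ → σ ⊑ inf limit → σ ≋ proj₁ (stage (length σ))
      down []      _       = tt
      down (π ▷ _) (p , q) = down π p , q

      up : ∀ σ → σ ≋ proj₁ (stage (length σ)) → σ ⊑ inf limit
      up []      _       = tt
      up (π ▷ _) (p , q) = up π p , q

-- Strategies that keep to safe positions

module _ {s : Side} {x : Hypergame} {K : Side} (f : Strategy s K x) where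

  -- Every move that f makes from a safe position leads to a safe position.

  Cautious : Set₁
  Cautious = ∀ π (p : turn s x π ≡ K) e → move f π p ≡ just e →
             Safe K (turn s x π) (last s x π) → Safe K (opp (turn s x π)) (proj₁ e)

  run-safe : Cautious → Safe K s x → (f′ : Strategy s (opp K) x) →
             ∀ μ → Run f f′ μ → Safe K (turn s x μ) (last s x μ)
  run-safe c safe f′ []      _                    = safe
  run-safe c safe f′ (π ▷ _) (r , a , ans , e≈a) =
    Safe-resp (≈-sym e≈a) (step ans)
    where
    safeπ = run-safe c safe f′ π r

    step : Answers f f′ π a → Safe K (opp (turn s x π)) (proj₁ a)
    step (inj₁ (p , eq)) = c π p a eq safeπ
    step (inj₂ (p , _))  = safe-opponent p safeπ (proj₂ a)

  cautious⇒nonLosing : ExcludedMiddle (suc 0ℓ) → Cautious → Safe K s x → NonLosing f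
  cautious⇒nonLosing em c safe f′
    with em {Σ (FinPlay s x) λ μ → Run f f′ μ × ¬ Extension s x μ}
  ... | no ¬stuck =
    let extend = λ μ r → decidable-stable em λ ¬e → ¬stuck (μ , r , ¬e)
    in  inf (limit f f′ extend) ,
        outcome-product f f′ (limit-outcome f f′ extend) , inj₂ tt
  ... | yes (μ , r , stuck) =
    fin μ , outcome-product f f′ (stuck-outcome f f′ r stuck) , inj₁ (opp-turn , none)
    where
    opp-turn : turn s x μ ≡ opp K
    opp-turn with side-cases K (turn s x μ)
    ... | inj₂ p = p
    ... | inj₁ p = contradiction (λ y m → stuck (y , m))
                     (safe-not-stuck p (run-safe c safe f′ μ r))

    none : ∀ y → ¬ (y ∈ last s x μ ^ opp K)
    none y m = stuck (y , subst (λ K → y ∈ last s x μ ^ K) (sym opp-turn) m)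

-- Choice of safe options

module _ (em : ExcludedMiddle (suc 0ℓ)) (ac : AxiomOfChoice 0ℓ (suc 0ℓ))
         (x : Hypergame) (K : Side) where

  -- The nodes of x, equal when they picture the same hypergame.

  nodes : Setoid 0ℓ (suc 0ℓ)
  nodes = record
    { Carrier       = Node x
    ; _≈_           = λ m n → at x m ≈ at x n
    ; isEquivalence = record { refl = ≈-refl ; sym = ≈-sym ; trans = ≈-trans }
    }

  -- m is a good reply of K at n: an option of n if there are any, and a safe
  -- one if n is safe.

  record Reply (n m : Node x) : Set₁ where
    field
      legal-reply : (∃ λ y → y ∈ at x n ^ K) → at x m ∈ at x n ^ K
      safe-reply  : Safe K K (at x n) → Safe K (opp K) (at x m)

  open Reply

  reply-respˡ : ∀ {m n n′} → at x n ≈ at x n′ → Reply n m → Reply n′ m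
  reply-respˡ n≈n′ r = record
    { legal-reply = λ (y , i) →
        ∈-respʳ K n≈n′ (legal-reply r (y , ∈-respʳ K (≈-sym n≈n′) i))
    ; safe-reply = λ safe → safe-reply r (Safe-resp (≈-sym n≈n′) safe)
    }

  reply-respʳ : ∀ {n m m′} → at x m ≈ at x m′ → Reply n m → Reply n m′
  reply-respʳ m≈m′ r = record
    { legal-reply = λ o → ∈-respˡ K m≈m′ (legal-reply r o)
    ; safe-reply  = λ safe → Safe-resp m≈m′ (safe-reply r safe)
    }

  reply-exists : ∀ n → ∃ (Reply n)
  reply-exists n with em {Safe K K (at x n)} | em {∃ λ y → y ∈ at x n ^ K}
  ... | yes safe | _ =
    let (y , (i , e) , safe′) = safe-option em refl safe
    in  next x K n i , record
          { legal-reply = λ _ → i , ≈-refl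
          ; safe-reply  = λ _ → Safe-resp (≈-sym e) safe′ }
  ... | no unsafe | yes (_ , i , _) =
    next x K n i , record
      { legal-reply = λ _ → i , ≈-refl
      ; safe-reply  = λ safe → contradiction safe unsafe }
  -- At an unsafe dead end any node will do.
  ... | no unsafe | no none = n , record
      { legal-reply = λ o → contradiction o none
      ; safe-reply  = λ safe → contradiction safe unsafe }

  private
    chosen : Σ (Func nodes nodes) λ c → ∀ n → Reply n (Func.to c n)
    chosen = ac nodes nodes Reply reply-respˡ reply-respʳ reply-exists

    open Func (proj₁ chosen) using () renaming (to to reply; cong to reply-cong)

    module _ {s : Side} where

      -- The last position of every play is pictured by a node of x.

      locate : (π : FinPlay s x) → Σ (Node x) λ n → at x n ≈ last s x π
      locate []            = root x , ≈-refl
      locate (π ▷ (y , m)) =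
        let (n , n≈)  = locate π
            (i , i≈y) = ∈-respʳ (turn s x π) (≈-sym n≈) m
        in  next x (turn s x π) n i , i≈y

      node : FinPlay s x → Node x
      node π = proj₁ (locate π)

      node-cong : ∀ {π σ} → π ≋ σ → at x (node π) ≈ at x (node σ)
      node-cong {π} {σ} p =
        ≈-trans (proj₂ (locate π)) (≈-trans (≋-last p) (≈-sym (proj₂ (locate σ))))

      respond : ∀ π → turn s x π ≡ K → Dec (Extension s x π) → Maybe (Extension s x π)
      respond π p (no _)        = nothing
      respond π p (yes (y , m)) = just (at x (reply (node π)) , member)
        where
        n≈ = proj₂ (locate π)

        member : at x (reply (node π)) ∈ last s x π ^ turn s x π
        member = subst (λ K → at x (reply (node π)) ∈ last s x π ^ K) (sym p)
          (∈-respʳ K n≈ (legal-reply (proj₂ chosen (node π))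
            (y , ∈-respʳ K (≈-sym n≈) (subst (λ K → y ∈ last s x π ^ K) p m))))

  -- The strategy that always moves to the chosen reply.

  cautious : ∀ s → Strategy s K x
  cautious s = record
    { move     = λ π p → respond π p em
    ; defined  = λ π p ext → total π p ext em
    ; respects = λ π≋σ p q → congruent π≋σ p q em em
    }
    where
    total : ∀ π p → Extension s x π → ∀ d → Is-just (respond π p d)
    total π p ext (yes _)   = just _
    total π p ext (no none) = contradiction ext none

    congruent : ∀ {π σ} → π ≋ σ → ∀ p q d d′ →
                Pointwise (λ e e′ → proj₁ e ≈ proj₁ e′) (respond π p d) (respond σ q d′)
    congruent π≋σ p q (yes _)   (yes _)   = just (reply-cong (node-cong π≋σ))
    congruent π≋σ p q (yes e)   (no none) = contradiction (≋-extension π≋σ e) none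
    congruent π≋σ p q (no none) (yes e)   = contradiction (≋-extension (≋-sym π≋σ) e) none
    congruent π≋σ p q (no _)    (no _)    = nothing

  cautious-isCautious : ∀ s → Cautious (cautious s)
  cautious-isCautious s π p e eq safe = go em eq
    where
    safe-node : Safe K K (at x (node π))
    safe-node = Safe-resp (≈-sym (proj₂ (locate π)))
                  (subst (λ t → Safe K t (last s x π)) p safe)

    go : ∀ d → respond π p d ≡ just e → Safe K (opp (turn s x π)) (proj₁ e)
    go (yes _) refl = subst (λ t → Safe K (opp t) (at x (reply (node π)))) (sym p)
                        (safe-reply (proj₂ chosen (node π)) safe-node)

  safe⇒nonLosing : ∀ s → Safe K s x → Σ (Strategy s K x) NonLosing
  safe⇒nonLosing s safe =
    cautious s , cautious⇒nonLosing (cautious s) em (cautious-isCautious s) safe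

-- Whoever starts, L or R has a non-losing strategy.

determined : ExcludedMiddle (suc 0ℓ) → AxiomOfChoice 0ℓ (suc 0ℓ) → ∀ x s →
             Σ (Strategy s L x) NonLosing ⊎ Σ (Strategy s R x) NonLosing
determined em ac x s with em {Wins R s x}
... | no safe = inj₁ (safe⇒nonLosing em ac x L s safe)
... | yes w   = inj₂ (safe⇒nonLosing em ac x R s (Wins-disjoint R w))

theorem2p13 : ExcludedMiddle (suc 0ℓ) → AxiomOfChoice 0ℓ (suc 0ℓ) →
    (x : Hypergame) →
    Σ Player λ P → Σ (PlayerStrategy P x) λ f → NonLosingᴾ P f
theorem2p13 em ac x with determined em ac x L | determined em ac x R
... | inj₁ (f , n) | inj₁ (g , m) = L  , (f , g) , n , m
... | inj₁ (f , n) | inj₂ (g , m) = I  , (f , g) , n , m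
... | inj₂ (f , n) | inj₁ (g , m) = II , (g , f) , m , n
... | inj₂ (f , n) | inj₂ (g , m) = R  , (g , f) , m , n
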